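{- The class of (countably infinite) modal algebras is not punctually robust: there exists a computable modal algebra that is not isomorphic to any punctual modal algebra.
   Context: Boolean algebras are considered in the signature $\{\cup,\cap,\mathrm C,0,1\}$. A modal algebra is a structure $(\mathcal B,f)$ where $\mathcal B$ is a Boolean algebra and $f\colon\mathcal B\to\mathcal B$ is a modality, i.e. $f(a\cup b)=f(a)\cup f(b)$ for all $a,b$ and $f(0)=0$. A structure is computable if its domain is a computable subset of $\mathbb N$ and its operations are computable; it is punctual if its domain is $\mathbb N$ and its operations are primitive recursive. A class is punctually robust if every computable member is isomorphic to a punctual structure. -}

module Defs where

open import Level using (0ℓ)
open import Data.Nat using (ℕ; zero; suc; _<_; _≤_)
open import Data.Fin using (Fin)
open import Data.Vec using (Vec; []; _∷_; lookup)
open import Data.Bool using (Bool; true; false)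
open import Data.Product using (Σ; ∃; _×_; _,_; proj₁)
open import Relation.Binary.PropositionalEquality using (_≡_)
open import Algebra.Lattice.Structures using (IsBooleanAlgebra)
open import Function.Definitions using (Bijective)

data PR : ℕ → Set where
  zeroᵖ : ∀ {n} → PR n
  succᵖ : PR 1
  projᵖ : ∀ {n} → Fin n → PR n
  compᵖ : ∀ {m n} → PR m → Vec (PR n) m → PR n
  recᵖ  : ∀ {n} → PR n → PR (suc (suc n)) → PR (suc n)

mutual
  ⟦_⟧ : ∀ {n} → PR n → Vec ℕ n → ℕ
  ⟦ zeroᵖ ⟧ v = 0
  ⟦ succᵖ ⟧ (x ∷ []) = suc x
  ⟦ projᵖ i ⟧ v = lookup v i
  ⟦ compᵖ g hs ⟧ v = ⟦ g ⟧ (⟦ hs ⟧* v)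
  ⟦ recᵖ g h ⟧ (zero ∷ v) = ⟦ g ⟧ v
  ⟦ recᵖ g h ⟧ (suc x ∷ v) = ⟦ h ⟧ (x ∷ ⟦ recᵖ g h ⟧ (x ∷ v) ∷ v)

  ⟦_⟧* : ∀ {m n} → Vec (PR n) m → Vec ℕ n → Vec ℕ m
  ⟦ [] ⟧* v = []
  ⟦ h ∷ hs ⟧* v = ⟦ h ⟧ v ∷ ⟦ hs ⟧* v

data Code : ℕ → Set where
  zeroᶜ : ∀ {n} → Code n
  succᶜ : Code 1
  projᶜ : ∀ {n} → Fin n → Code n
  compᶜ : ∀ {m n} → Code m → Vec (Code n) m → Code n
  recᶜ  : ∀ {n} → Code n → Code (suc (suc n)) → Code (suc n)
  μᶜ    : ∀ {n} → Code (suc n) → Code n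

mutual
  data _[_]⇓_ : ∀ {n} → Code n → Vec ℕ n → ℕ → Set where
    ⇓zero : ∀ {n} {v : Vec ℕ n} → zeroᶜ [ v ]⇓ 0
    ⇓succ : ∀ {x} → succᶜ [ x ∷ [] ]⇓ suc x
    ⇓proj : ∀ {n} {i : Fin n} {v} → projᶜ i [ v ]⇓ lookup v i
    ⇓comp : ∀ {m n} {g : Code m} {hs : Vec (Code n) m} {v ws y} →
            hs [ v ]⇓* ws → g [ ws ]⇓ y → compᶜ g hs [ v ]⇓ y
    ⇓rec0 : ∀ {n} {g : Code n} {h v y} → g [ v ]⇓ y → recᶜ g h [ zero ∷ v ]⇓ y
    ⇓recS : ∀ {n} {g : Code n} {h x v z y} →
            recᶜ g h [ x ∷ v ]⇓ z → h [ x ∷ z ∷ v ]⇓ y →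
            recᶜ g h [ suc x ∷ v ]⇓ y
    ⇓μ    : ∀ {n} {e : Code (suc n)} {v y} →
            e [ y ∷ v ]⇓ 0 →
            (∀ z → z < y → ∃ λ k → e [ z ∷ v ]⇓ suc k) →
            μᶜ e [ v ]⇓ y

  data _[_]⇓*_ : ∀ {m n} → Vec (Code n) m → Vec ℕ n → Vec ℕ m → Set where
    []⇓ : ∀ {n} {v : Vec ℕ n} → [] [ v ]⇓* []
    ∷⇓  : ∀ {m n} {h : Code n} {hs : Vec (Code n) m} {v y ys} →
          h [ v ]⇓ y → hs [ v ]⇓* ys → (h ∷ hs) [ v ]⇓* (y ∷ ys)

Computable : ∀ {n} → (Vec ℕ n → ℕ) → Set
Computable {n} f = Σ (Code n) λ e → ∀ v → e [ v ]⇓ f v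

PrimRec : ∀ {n} → (Vec ℕ n → ℕ) → Set
PrimRec {n} f = Σ (PR n) λ p → ∀ v → ⟦ p ⟧ v ≡ f v

un : (ℕ → ℕ) → Vec ℕ 1 → ℕ
un f (x ∷ []) = f x

bin : (ℕ → ℕ → ℕ) → Vec ℕ 2 → ℕ
bin f (x ∷ y ∷ []) = f x y

boolToℕ : Bool → ℕ
boolToℕ true = 1
boolToℕ false = 0

record MAOps (A : Set) : Set where
  field
    _∪_ _∩_ : A → A → A
    C       : A → A
    𝟎 𝟏     : A
    f       : A → A

IsModalAlgebra : ∀ {A} → MAOps A → Set
IsModalAlgebra {A} M =
  IsBooleanAlgebra {A = A} _≡_ _∪_ _∩_ C 𝟏 𝟎
  × (∀ a b → f (a ∪ b) ≡ (f a ∪ f b))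
  × (f 𝟎 ≡ 𝟎)
  where open MAOps M

record _≅_ {A B : Set} (M : MAOps A) (N : MAOps B) : Set where
  private
    module M = MAOps M
    module N = MAOps N
  field
    h       : A → B
    h-bij   : Bijective _≡_ _≡_ h
    h-∪     : ∀ a b → h (a M.∪ b) ≡ (h a N.∪ h b)
    h-∩     : ∀ a b → h (a M.∩ b) ≡ (h a N.∩ h b)
    h-C     : ∀ a → h (M.C a) ≡ N.C (h a)
    h-𝟎     : h M.𝟎 ≡ N.𝟎
    h-𝟏     : h M.𝟏 ≡ N.𝟏
    h-f     : ∀ a → h (M.f a) ≡ N.f (h a)

record ℕPresentation : Set where
  field
    dom     : ℕ → Bool
    cup cap : ℕ → ℕ → ℕ
    cmp     : ℕ → ℕ
    zer one : ℕ
    mod     : ℕ → ℕ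
    cup-cl  : ∀ x y → dom x ≡ true → dom y ≡ true → dom (cup x y) ≡ true
    cap-cl  : ∀ x y → dom x ≡ true → dom y ≡ true → dom (cap x y) ≡ true
    cmp-cl  : ∀ x → dom x ≡ true → dom (cmp x) ≡ true
    zer-cl  : dom zer ≡ true
    one-cl  : dom one ≡ true
    mod-cl  : ∀ x → dom x ≡ true → dom (mod x) ≡ true

  Dom : Set
  Dom = Σ ℕ λ x → dom x ≡ true

  ops : MAOps Dom
  ops = record
    { _∪_ = λ { (x , p) (y , q) → cup x y , cup-cl x y p q }
    ; _∩_ = λ { (x , p) (y , q) → cap x y , cap-cl x y p q }
    ; C   = λ { (x , p) → cmp x , cmp-cl x p }
    ; 𝟎   = zer , zer-cl
    ; 𝟏   = one , one-cl
    ; f   = λ { (x , p) → mod x , mod-cl x p }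
    }

IsComputable : ℕPresentation → Set
IsComputable P =
  Computable (un (λ x → boolToℕ (dom x)))
  × Computable (bin cup) × Computable (bin cap)
  × Computable (un cmp) × Computable (un mod)
  where open ℕPresentation P

InfiniteDom : ℕPresentation → Set
InfiniteDom P = ∀ n → ∃ λ m → n ≤ m × ℕPresentation.dom P m ≡ true

IsPunctual : MAOps ℕ → Set
IsPunctual M =
  PrimRec (bin _∪_) × PrimRec (bin _∩_)
  × PrimRec (un C) × PrimRec (un f)
  where open MAOps M

{-# OPTIONS --safe #-}

-- Take the algebra of finite and cofinite subsets of ℕ with
--   f(a) = { i + 1 ∣ i ∈ a } ∪ E(a),
-- where E(a) = { 1 } if a is cofinite or contains n + 1 for some n ∈ S, and E(a) = ∅ otherwise.
-- The closed terms b = f(C(f(1))), p₀ = b, pₙ₊₁ = f(pₙ) ∩ C(b) denote b = { 1 } and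
-- pₙ = { n + 1 }, so f(pₙ) ∩ b = 0 exactly when n ∉ S.  In a punctual copy both sides are
-- primitive recursive in n and equality is equality of numbers, so S is primitive recursive;
-- it remains to make S computable but not primitive recursive.  For that, S diagonalises against
-- a universal stack machine for primitive recursion that halts on every input.
module Submission where

open import Defs
open import Algebra.Lattice.Structures using (IsBooleanAlgebra)
open import Data.Bool using (Bool; true; false; not; if_then_else_; _∨_; _∧_; _xor_)
import Data.Bool.Properties as Bool
open import Data.Fin using (Fin; zero; suc)
open import Data.Fin.Patterns using (0F; 1F; 2F; 3F; 4F)
open import Data.Nat
open import Data.Nat.Induction using (<-wellFounded)
open import Data.Nat.Properties
open import Data.Product using (Σ; ∃; _×_; _,_; proj₁; proj₂)
open import Data.Sum using (inj₁; inj₂)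
open import Data.Vec using (Vec; []; _∷_; lookup; head; tail; tabulate)
open import Data.Vec.Properties using (tabulate∘lookup)
open import Induction.WellFounded using (Acc; acc)
open import Relation.Binary.PropositionalEquality
open import Relation.Nullary using (¬_; yes; no; contradiction)

-- Closure properties of computable functions

-- The signature dictates how S is stored. As 0 is no successor, f(1) omits exactly 0, so { 0 } is
-- definable; the mark sits at 1 because f({ 0 }) = { 1 } is then definable too, for every S.
-- Element 0 cannot carry information, its successor being the mark itself, so n is represented by n
-- + 1, whose successor never collides with the mark. Counting every cofinite set as marked leaves
-- only finite sets to search, and f stays additive because a union of two finite sets is finite.
--
-- The laborious part is a `Code` for the diagonal set: an evaluator by recursion on the syntax `PR`
-- is not one. Hence programs are numbers, one machine step is computable, and evaluation is a
-- single minimisation over the number of steps. Every number is a halting program, so this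
-- minimisation is total and no code needs a validity check.

ComputableVec : ∀ {n m} → (Vec ℕ n → Vec ℕ m) → Set
ComputableVec {n} {m} F = Σ (Vec (Code n) m) λ es → ∀ v → es [ v ]⇓* F v

[]ᵛ : ∀ {n} → ComputableVec {n} (λ _ → [])
[]ᵛ = [] , λ _ → []⇓

infixr 5 _∷ᵛ_
_∷ᵛ_ : ∀ {n m} {g : Vec ℕ n → ℕ} {F : Vec ℕ n → Vec ℕ m} →
       Computable g → ComputableVec F → ComputableVec (λ v → g v ∷ F v)
(e , e⇓) ∷ᵛ (es , es⇓) = e ∷ es , λ v → ∷⇓ (e⇓ v) (es⇓ v)

infixr 4 _⊙_
_⊙_ : ∀ {n m} {g : Vec ℕ m → ℕ} {F : Vec ℕ n → Vec ℕ m} →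
      Computable g → ComputableVec F → Computable (λ v → g (F v))
_⊙_ {F = F} (e , e⇓) (es , es⇓) = compᶜ e es , λ v → ⇓comp (es⇓ v) (e⇓ (F v))

-- A function that matches on its argument vector is only pointwise equal to one assembled from
-- projections; this passes between the two, usually by `refl` after matching.
computable-resp-≗ : ∀ {n} {g g′ : Vec ℕ n → ℕ} → g ≗ g′ → Computable g → Computable g′
computable-resp-≗ eq (e , e⇓) = e , λ v → subst (e [ v ]⇓_) (eq v) (e⇓ v)

arg : ∀ {n} (i : Fin n) → Computable (λ v → lookup v i)
arg i = projᶜ i , λ v → ⇓proj

computableVec-resp-≗ : ∀ {n m} {F F′ : Vec ℕ n → Vec ℕ m} → F ≗ F′ → ComputableVec F → ComputableVec F′
computableVec-resp-≗ eq (es , es⇓) = es , λ v → subst (es [ v ]⇓*_) (eq v) (es⇓ v)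

args : ∀ {n m} (ρ : Fin m → Fin n) → ComputableVec (λ v → tabulate (λ i → lookup v (ρ i)))
args {m = zero}  ρ = []ᵛ
args {m = suc m} ρ = arg (ρ zero) ∷ᵛ args (λ i → ρ (suc i))

args₀ : ∀ {n} → ComputableVec {n} (λ v → v)
args₀ = computableVec-resp-≗ tabulate∘lookup (args λ i → i)

-- The parameters of a recursion step, without the counter and the previous value.
args₂ : ∀ {n} → ComputableVec {suc (suc n)} (λ v → tail (tail v))
args₂ = computableVec-resp-≗ (λ { (x ∷ y ∷ v) → tabulate∘lookup v }) (args λ i → suc (suc i))

-- `F` may be any function satisfying the two recursion equations, so definitions by pattern
-- matching receive codes as they stand.
primrec : ∀ {n} {G : Vec ℕ n → ℕ} {H : Vec ℕ (suc (suc n)) → ℕ} {F : Vec ℕ (suc n) → ℕ} →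
          Computable G → Computable H →
          (∀ v → G v ≡ F (0 ∷ v)) →
          (∀ x v → H (x ∷ F (x ∷ v) ∷ v) ≡ F (suc x ∷ v)) →
          Computable F
primrec {n} {F = F} (g , g⇓) (h , h⇓) F-zero F-suc = recᶜ g h , λ { (x ∷ v) → rec⇓ x v }
  where
  rec⇓ : ∀ x v → recᶜ g h [ x ∷ v ]⇓ F (x ∷ v)
  rec⇓ zero    v = subst (recᶜ g h [ zero ∷ v ]⇓_) (F-zero v) (⇓rec0 (g⇓ v))
  rec⇓ (suc x) v = subst (recᶜ g h [ suc x ∷ v ]⇓_) (F-suc x v) (⇓recS (rec⇓ x v) (h⇓ _))

caseℕ : ∀ {n} {F : Vec ℕ (suc n) → ℕ} →
        Computable (λ v → F (0 ∷ v)) →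
        Computable {suc n} (λ w → F (suc (head w) ∷ tail w)) →
        Computable F
caseℕ g h = primrec g (h ⊙ arg 0F ∷ᵛ args₂) (λ _ → refl) (λ _ _ → refl)

-- The known zero `t` only bounds the recursion; the last component has the shape of the second
-- premise of `⇓μ`.
least-zero : ∀ (g : ℕ → ℕ) t → g t ≡ 0 →
             ∃ λ m → g m ≡ 0 × (∀ z → z < m → ∃ λ k → g z ≡ suc k)
least-zero g zero    gt≡0 = 0 , gt≡0 , λ _ ()
least-zero g (suc t) gt≡0 with g 0 in eq | least-zero (λ s → g (suc s)) t gt≡0
... | zero  | _                = 0 , eq , λ _ ()
... | suc k | m , gm≡0 , below = suc m , gm≡0 , λ { zero _ → k , eq ; (suc z) (s≤s z<m) → below z z<m }

abstract
  minimise : ∀ {n} (g : Vec ℕ (suc n) → ℕ) → (∀ v → ∃ λ t → g (t ∷ v) ≡ 0) → Vec ℕ n → ℕ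
  minimise g total v = proj₁ (least-zero (λ t → g (t ∷ v)) (proj₁ (total v)) (proj₂ (total v)))

  minimise-zero : ∀ {n} (g : Vec ℕ (suc n) → ℕ) total v → g (minimise g total v ∷ v) ≡ 0
  minimise-zero g total v = proj₁ (proj₂ (least-zero (λ t → g (t ∷ v)) (proj₁ (total v)) (proj₂ (total v))))

  minimise-computable : ∀ {n} (g : Vec ℕ (suc n) → ℕ) (total : ∀ v → ∃ λ t → g (t ∷ v) ≡ 0) →
                        Computable g → Computable (minimise g total)
  minimise-computable g total (e , e⇓) = μᶜ e , λ v →
    let (m , gm≡0 , below) = least-zero (λ t → g (t ∷ v)) (proj₁ (total v)) (proj₂ (total v)) in
    ⇓μ (subst (e [ m ∷ v ]⇓_) gm≡0 (e⇓ _))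
       (λ z z<m → let (k , eq) = below z z<m in k , subst (e [ z ∷ v ]⇓_) eq (e⇓ _))

-- Arithmetic and Boolean functions

module _ {n : ℕ} where

  zero° : Computable {n} (λ _ → 0)
  zero° = zeroᶜ , λ _ → ⇓zero

  suc° : {a : Vec ℕ n → ℕ} → Computable a → Computable (λ v → suc (a v))
  suc° ca = computable-resp-≗ (λ _ → refl) (suc-computable ⊙ ca ∷ᵛ []ᵛ)
    where
    suc-computable : Computable (un suc)
    suc-computable = succᶜ , λ { (x ∷ []) → ⇓succ }

  const° : (k : ℕ) → Computable {n} (λ _ → k)
  const° zero    = zero°
  const° (suc k) = suc° (const° k)

+-computable : Computable (bin _+_)
+-computable = primrec (arg 0F) (suc° (arg 1F)) (λ { (y ∷ []) → refl }) (λ { x (y ∷ []) → refl })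

∸-computable : Computable (bin _∸_)
∸-computable = computable-resp-≗ (λ { (x ∷ y ∷ []) → refl }) (flipped ⊙ arg 1F ∷ᵛ arg 0F ∷ᵛ []ᵛ)
  where
  pred-computable : Computable (un pred)
  pred-computable = caseℕ (computable-resp-≗ (λ { [] → refl }) zero°)
                          (computable-resp-≗ (λ { (x ∷ []) → refl }) (arg 0F))
  flipped : Computable (bin λ y x → x ∸ y)
  flipped = primrec (arg 0F) (pred-computable ⊙ arg 1F ∷ᵛ []ᵛ)
              (λ { (x ∷ []) → refl }) (λ { y (x ∷ []) → pred[m∸n]≡m∸[1+n] x y })

ComputableBool : ∀ {n} → (Vec ℕ n → Bool) → Set
ComputableBool P = Computable (λ v → boolToℕ (P v))

module _ {n : ℕ} where

  infixl 6 _+°_ _∸°_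
  _+°_ : {a b : Vec ℕ n → ℕ} → Computable a → Computable b → Computable (λ v → a v + b v)
  ca +° cb = +-computable ⊙ ca ∷ᵛ cb ∷ᵛ []ᵛ

  _∸°_ : {a b : Vec ℕ n → ℕ} → Computable a → Computable b → Computable (λ v → a v ∸ b v)
  ca ∸° cb = ∸-computable ⊙ ca ∷ᵛ cb ∷ᵛ []ᵛ

  if° : {P : Vec ℕ n → Bool} {a b : Vec ℕ n → ℕ} → ComputableBool P → Computable a → Computable b →
        Computable (λ v → if P v then a v else b v)
  if° {P} {a} {b} cP ca cb =
    computable-resp-≗ (λ v → branch-if (P v) (a v) (b v)) (branch-computable ⊙ cP ∷ᵛ ca ∷ᵛ cb ∷ᵛ []ᵛ)
    where
    branch : Vec ℕ 3 → ℕ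
    branch (zero  ∷ x ∷ y ∷ []) = y
    branch (suc _ ∷ x ∷ y ∷ []) = x
    branch-computable : Computable branch
    branch-computable = caseℕ (computable-resp-≗ (λ { (x ∷ y ∷ []) → refl }) (arg 1F))
                              (computable-resp-≗ (λ { (_ ∷ x ∷ y ∷ []) → refl }) (arg 1F))
    branch-if : ∀ p x y → branch (boolToℕ p ∷ x ∷ y ∷ []) ≡ (if p then x else y)
    branch-if true  x y = refl
    branch-if false x y = refl

  map° : {P : Vec ℕ n → Bool} (op : Bool → Bool) → ComputableBool P → ComputableBool (λ v → op (P v))
  map° {P} op cP = computable-resp-≗ (λ v → if-η (P v))
    (if° cP (const° (boolToℕ (op true))) (const° (boolToℕ (op false))))
    where
    if-η : ∀ p → (if p then boolToℕ (op true) else boolToℕ (op false)) ≡ boolToℕ (op p)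
    if-η true  = refl
    if-η false = refl

  zip° : {P Q : Vec ℕ n → Bool} (op : Bool → Bool → Bool) → ComputableBool P → ComputableBool Q →
         ComputableBool (λ v → op (P v) (Q v))
  zip° {P} {Q} op cP cQ = computable-resp-≗ (λ v → if-η (P v) (Q v))
    (if° cP (map° (op true) cQ) (map° (op false) cQ))
    where
    if-η : ∀ p q → (if p then boolToℕ (op true q) else boolToℕ (op false q)) ≡ boolToℕ (op p q)
    if-η true  q = refl
    if-η false q = refl

  isZero° : {a : Vec ℕ n → ℕ} → Computable a → ComputableBool (λ v → a v ≡ᵇ 0)
  isZero° ca = isZero-computable ⊙ ca ∷ᵛ []ᵛ
    where
    isZero-computable : Computable (un λ x → boolToℕ (x ≡ᵇ 0))
    isZero-computable = caseℕ (computable-resp-≗ (λ { [] → refl }) (const° 1))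
                              (computable-resp-≗ (λ { (x ∷ []) → refl }) zero°)

-- Cantor pairing

triangle : ℕ → ℕ
triangle zero    = 0
triangle (suc s) = suc s + triangle s

root : ℕ → ℕ
root zero    = 0
root (suc n) = if triangle (suc (root n)) ∸ suc n ≡ᵇ 0 then suc (root n) else root n

triangle-computable : Computable (un triangle)
triangle-computable = primrec zero° (suc° (arg 0F) +° arg 1F) (λ { [] → refl }) (λ { x [] → refl })

root-computable : Computable (un root)
root-computable = primrec zero°
  (if° (isZero° ((triangle-computable ⊙ suc° (arg 1F) ∷ᵛ []ᵛ) ∸° suc° (arg 0F))) (suc° (arg 1F)) (arg 1F))
  (λ { [] → refl }) (λ { x [] → refl })

n≤triangle : ∀ n → n ≤ triangle n
n≤triangle zero    = z≤n
n≤triangle (suc n) = m≤m+n (suc n) (triangle n)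

-- Follows the diagonals of the pairing: the number before `triangle (suc s)` is `triangle s + s`,
-- the end of the previous diagonal, and only there does the test in `root` succeed.
root-triangle : ∀ s b → b ≤ s → root (triangle s + b) ≡ s
root-triangle zero    zero    _ = refl
root-triangle (suc s) zero    _
  rewrite +-identityʳ (s + triangle s) | +-comm s (triangle s) | root-triangle s s ≤-refl
        | +-comm s (triangle s) | n∸n≡0 (triangle s + s) = refl
root-triangle s       (suc b) b<s
  rewrite +-suc (triangle s) b | root-triangle s b (<⇒≤ b<s) | +-comm s (triangle s)
        | [m+n]∸[m+o]≡n∸o (triangle s) s b | +-∸-assoc 1 b<s = refl

triangular-decomposition : ∀ n → ∃ λ s → ∃ λ b → b ≤ s × n ≡ triangle s + b
triangular-decomposition zero = 0 , 0 , z≤n , refl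
triangular-decomposition (suc n) with triangular-decomposition n
... | s , b , b≤s , n≡ with m≤n⇒m<n∨m≡n b≤s
...   | inj₁ b<s  = s , suc b , b<s , trans (cong suc n≡) (sym (+-suc (triangle s) b))
...   | inj₂ refl = suc s , 0 , z≤n ,
                    cong suc (trans n≡ (trans (+-comm (triangle s) s) (sym (+-identityʳ _))))

abstract
  ⟨_,_⟩ : ℕ → ℕ → ℕ
  ⟨ a , b ⟩ = triangle (a + b) + b

  fst snd : ℕ → ℕ
  snd n = n ∸ triangle (root n)
  fst n = root n ∸ snd n

  snd-pair : ∀ a b → snd ⟨ a , b ⟩ ≡ b
  snd-pair a b rewrite root-triangle (a + b) b (m≤n+m b a) = m+n∸m≡n (triangle (a + b)) b

  fst-pair : ∀ a b → fst ⟨ a , b ⟩ ≡ a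
  fst-pair a b rewrite snd-pair a b | root-triangle (a + b) b (m≤n+m b a) = m+n∸n≡m a b

  pair-surjective : ∀ n → ∃ λ a → ∃ λ b → n ≡ ⟨ a , b ⟩
  pair-surjective n with triangular-decomposition n
  ... | s , b , b≤s , n≡ = s ∸ b , b , trans n≡ (cong (λ r → triangle r + b) (sym (m∸n+n≡m b≤s)))

  +≤pair : ∀ a b → a + b ≤ ⟨ a , b ⟩
  +≤pair a b = ≤-trans (n≤triangle (a + b)) (m≤m+n _ b)

  pair-computable : Computable (bin ⟨_,_⟩)
  pair-computable = computable-resp-≗ (λ { (a ∷ b ∷ []) → refl })
    ((triangle-computable ⊙ arg 0F +° arg 1F ∷ᵛ []ᵛ) +° arg 1F)

  snd-computable : Computable (un snd)
  snd-computable = computable-resp-≗ (λ { (n ∷ []) → refl })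
    (arg 0F ∸° (triangle-computable ⊙ (root-computable ⊙ arg 0F ∷ᵛ []ᵛ) ∷ᵛ []ᵛ))

  fst-computable : Computable (un fst)
  fst-computable = computable-resp-≗ (λ { (n ∷ []) → refl })
    ((root-computable ⊙ arg 0F ∷ᵛ []ᵛ) ∸° (snd-computable ⊙ arg 0F ∷ᵛ []ᵛ))

module _ {n : ℕ} where

  pair° : {a b : Vec ℕ n → ℕ} → Computable a → Computable b → Computable (λ v → ⟨ a v , b v ⟩)
  pair° ca cb = pair-computable ⊙ ca ∷ᵛ cb ∷ᵛ []ᵛ

  fst° : {a : Vec ℕ n → ℕ} → Computable a → Computable (λ v → fst (a v))
  fst° ca = fst-computable ⊙ ca ∷ᵛ []ᵛ

  snd° : {a : Vec ℕ n → ℕ} → Computable a → Computable (λ v → snd (a v))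
  snd° ca = snd-computable ⊙ ca ∷ᵛ []ᵛ

-- A universal machine for primitive recursion

-- An instruction is a number ⟨ tag , ⟨ a , b ⟩ ⟩; a state ⟨ k , x ⟩ consists of a stack k of
-- instructions (0 is the empty stack) and a value x.  With a and b read as instructions
-- or as stored values, the tags mean:
--   0  x ↦ 0         3  x ↦ snd x         6      x ↦ ⟨ a x , b x ⟩
--   1  x ↦ suc x     4  x ↦ ⟨ a , x ⟩     7      x ↦ ⟨ x , a b ⟩
--   2  x ↦ fst x     5  x ↦ b (a x)       8, …   ⟨ n , y ⟩ ↦ aⁿ y
infixr 5 _▹_
_▹_ : ℕ → ℕ → ℕ
c ▹ k = suc ⟨ c , k ⟩

instr : ℕ → ℕ → ℕ → ℕ
instr t a b = ⟨ t , ⟨ a , b ⟩ ⟩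

-- While `a` runs, the remaining count waits on the stack as the operand of an instruction with tag
-- 4, which pairs it with the result for the next round.
loop : Vec ℕ 5 → ℕ
loop (zero  ∷ a ∷ b ∷ k ∷ y ∷ []) = ⟨ k , y ⟩
loop (suc n ∷ a ∷ b ∷ k ∷ y ∷ []) = ⟨ a ▹ instr 4 n 0 ▹ instr 8 a b ▹ k , y ⟩

-- Tag 7 acts as a closure: tag 6 creates it at run time to keep `x` while `a` runs. All tags from 8
-- on mean the same, so no instruction gets stuck.
execute : Vec ℕ 5 → ℕ
execute (0 ∷ a ∷ b ∷ k ∷ x ∷ []) = ⟨ k , 0 ⟩
execute (1 ∷ a ∷ b ∷ k ∷ x ∷ []) = ⟨ k , suc x ⟩
execute (2 ∷ a ∷ b ∷ k ∷ x ∷ []) = ⟨ k , fst x ⟩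
execute (3 ∷ a ∷ b ∷ k ∷ x ∷ []) = ⟨ k , snd x ⟩
execute (4 ∷ a ∷ b ∷ k ∷ x ∷ []) = ⟨ k , ⟨ a , x ⟩ ⟩
execute (5 ∷ a ∷ b ∷ k ∷ x ∷ []) = ⟨ a ▹ b ▹ k , x ⟩
execute (6 ∷ a ∷ b ∷ k ∷ x ∷ []) = ⟨ a ▹ instr 7 b x ▹ k , x ⟩
execute (7 ∷ a ∷ b ∷ k ∷ x ∷ []) = ⟨ a ▹ instr 4 x 0 ▹ k , b ⟩
execute (suc (suc (suc (suc (suc (suc (suc (suc _))))))) ∷ a ∷ b ∷ k ∷ x ∷ []) =
  loop (fst x ∷ a ∷ b ∷ k ∷ snd x ∷ [])

stepFrom : Vec ℕ 2 → ℕ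
stepFrom (zero  ∷ x ∷ []) = ⟨ 0 , x ⟩
stepFrom (suc k ∷ x ∷ []) =
  execute (fst (fst k) ∷ fst (snd (fst k)) ∷ snd (snd (fst k)) ∷ snd k ∷ x ∷ [])

step : ℕ → ℕ
step σ = stepFrom (fst σ ∷ snd σ ∷ [])

steps : ℕ → ℕ → ℕ
steps zero    σ = σ
steps (suc t) σ = step (steps t σ)

steps-computable : Computable (bin steps)
steps-computable = primrec (arg 0F)
  (step-computable ⊙ fst° (arg 1F) ∷ᵛ snd° (arg 1F) ∷ᵛ []ᵛ)
  (λ { (σ ∷ []) → refl }) (λ { t (σ ∷ []) → refl })
  where
  push° : ∀ {n} {a b : Vec ℕ n → ℕ} → Computable a → Computable b → Computable (λ v → a v ▹ b v)
  push° ca cb = suc° (pair° ca cb)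
  instr° : ∀ {n} {a b : Vec ℕ n → ℕ} t → Computable a → Computable b → Computable (λ v → instr t (a v) (b v))
  instr° t ca cb = pair° (const° t) (pair° ca cb)
  loop-computable : Computable loop
  loop-computable = caseℕ
    (computable-resp-≗ (λ { (a ∷ b ∷ k ∷ y ∷ []) → refl }) (pair° (arg 2F) (arg 3F)))
    (computable-resp-≗ (λ { (n ∷ a ∷ b ∷ k ∷ y ∷ []) → refl })
      (pair° (push° (arg 1F) (push° (instr° 4 (arg 0F) zero°)
                (push° (instr° 8 (arg 1F) (arg 2F)) (arg 3F)))) (arg 4F)))
  execute-computable : Computable execute
  execute-computable =
    caseℕ (leaf 0 zero° (λ _ _ _ _ → refl))
    (caseℕ (leaf 1 (suc° (arg 3F)) (λ _ _ _ _ → refl))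
    (caseℕ (leaf 2 (fst° (arg 3F)) (λ _ _ _ _ → refl))
    (caseℕ (leaf 3 (snd° (arg 3F)) (λ _ _ _ _ → refl))
    (caseℕ (leaf 4 (pair° (arg 0F) (arg 3F)) (λ _ _ _ _ → refl))
    (caseℕ (computable-resp-≗ (λ { (a ∷ b ∷ k ∷ x ∷ []) → refl })
             (pair° (push° (arg 0F) (push° (arg 1F) (arg 2F))) (arg 3F)))
    (caseℕ (computable-resp-≗ (λ { (a ∷ b ∷ k ∷ x ∷ []) → refl })
             (pair° (push° (arg 0F) (push° (instr° 7 (arg 1F) (arg 3F)) (arg 2F))) (arg 3F)))
    (caseℕ (computable-resp-≗ (λ { (a ∷ b ∷ k ∷ x ∷ []) → refl })
             (pair° (push° (arg 0F) (push° (instr° 4 (arg 3F) zero°) (arg 2F))) (arg 1F)))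
    (computable-resp-≗ (λ { (_ ∷ a ∷ b ∷ k ∷ x ∷ []) → refl })
      (loop-computable ⊙ fst° (arg 4F) ∷ᵛ arg 1F ∷ᵛ arg 2F ∷ᵛ arg 3F ∷ᵛ snd° (arg 4F) ∷ᵛ []ᵛ)))))))))
    where
    leaf : ∀ t {g : Vec ℕ 4 → ℕ} → Computable g →
           (∀ a b k x → ⟨ k , g (a ∷ b ∷ k ∷ x ∷ []) ⟩ ≡ execute (t ∷ a ∷ b ∷ k ∷ x ∷ [])) →
           Computable (λ v → execute (t ∷ v))
    leaf t cg eq = computable-resp-≗ (λ { (a ∷ b ∷ k ∷ x ∷ []) → eq a b k x }) (pair° (arg 2F) cg)
  step-computable : Computable stepFrom
  step-computable = caseℕ
    (computable-resp-≗ (λ { (x ∷ []) → refl }) (pair° zero° (arg 0F)))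
    (computable-resp-≗ (λ { (k ∷ x ∷ []) → refl })
      (execute-computable ⊙ fst° (fst° (arg 0F)) ∷ᵛ fst° (snd° (fst° (arg 0F)))
         ∷ᵛ snd° (snd° (fst° (arg 0F))) ∷ᵛ snd° (arg 0F) ∷ᵛ arg 1F ∷ᵛ []ᵛ))

steps-+ : ∀ s t σ → steps (s + t) σ ≡ steps s (steps t σ)
steps-+ zero    t σ = refl
steps-+ (suc s) t σ = cong step (steps-+ s t σ)

step-halted : ∀ σ → fst σ ≡ 0 → step σ ≡ σ
step-halted σ fst≡0 with pair-surjective σ
... | a , x , refl rewrite fst≡0 | snd-pair a x = cong ⟨_, x ⟩ (trans (sym fst≡0) (fst-pair a x))

steps-halted : ∀ t σ → fst σ ≡ 0 → steps t σ ≡ σ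
steps-halted zero    σ fst≡0 = refl
steps-halted (suc t) σ fst≡0 = trans (cong step (steps-halted t σ fst≡0)) (step-halted σ fst≡0)

-- Halted states are fixed by `step`. This lets `universal` use the least halting time while a
-- correctness proof supplies another.
halted-unique : ∀ s t σ → fst (steps s σ) ≡ 0 → fst (steps t σ) ≡ 0 → steps s σ ≡ steps t σ
halted-unique s t σ s-halts t-halts with ≤-total s t
... | inj₁ s≤t = sym (begin
  steps t σ                     ≡⟨ cong (λ r → steps r σ) (m∸n+n≡m s≤t) ⟨
  steps (t ∸ s + s) σ           ≡⟨ steps-+ (t ∸ s) s σ ⟩
  steps (t ∸ s) (steps s σ)     ≡⟨ steps-halted (t ∸ s) _ s-halts ⟩
  steps s σ                     ∎)
  where open ≡-Reasoning
... | inj₂ t≤s = begin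
  steps s σ                     ≡⟨ cong (λ r → steps r σ) (m∸n+n≡m t≤s) ⟨
  steps (s ∸ t + t) σ           ≡⟨ steps-+ (s ∸ t) t σ ⟩
  steps (s ∸ t) (steps t σ)     ≡⟨ steps-halted (s ∸ t) _ t-halts ⟩
  steps t σ                     ∎
  where open ≡-Reasoning

infix 4 _↝_
_↝_ : ℕ → ℕ → Set
σ ↝ τ = ∃ λ t → steps t σ ≡ τ

↝-trans : ∀ {ρ σ τ} → ρ ↝ σ → σ ↝ τ → ρ ↝ τ
↝-trans {ρ} (s , ρ↝σ) (t , σ↝τ) = t + s , trans (steps-+ t s ρ) (trans (cong (steps t) ρ↝σ) σ↝τ)

execute↝ : ∀ t a b k x → ⟨ instr t a b ▹ k , x ⟩ ↝ execute (t ∷ a ∷ b ∷ k ∷ x ∷ [])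
execute↝ t a b k x = 1 , eq
  where
  eq : step ⟨ instr t a b ▹ k , x ⟩ ≡ execute (t ∷ a ∷ b ∷ k ∷ x ∷ [])
  eq rewrite fst-pair (instr t a b ▹ k) x | snd-pair (instr t a b ▹ k) x
           | fst-pair (instr t a b) k | snd-pair (instr t a b) k
           | fst-pair t ⟨ a , b ⟩ | snd-pair t ⟨ a , b ⟩ | fst-pair a b | snd-pair a b = refl

-- Quantifying over the rest `k` of the stack makes runs compose: an instruction finishes without
-- touching what lies below it.
_∶_⟼_ : ℕ → ℕ → ℕ → Set
c ∶ x ⟼ y = ∀ k → ⟨ c ▹ k , x ⟩ ↝ ⟨ k , y ⟩

zero-⟼ : ∀ {a b x} → instr 0 a b ∶ x ⟼ 0
zero-⟼ k = execute↝ 0 _ _ k _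

suc-⟼ : ∀ {a b x} → instr 1 a b ∶ x ⟼ suc x
suc-⟼ k = execute↝ 1 _ _ k _

fst-⟼ : ∀ {a b x} → instr 2 a b ∶ x ⟼ fst x
fst-⟼ k = execute↝ 2 _ _ k _

snd-⟼ : ∀ {a b x} → instr 3 a b ∶ x ⟼ snd x
snd-⟼ k = execute↝ 3 _ _ k _

store-⟼ : ∀ {a b x} → instr 4 a b ∶ x ⟼ ⟨ a , x ⟩
store-⟼ k = execute↝ 4 _ _ k _

seq-⟼ : ∀ {a b x y z} → a ∶ x ⟼ y → b ∶ y ⟼ z → instr 5 a b ∶ x ⟼ z
seq-⟼ a⟼ b⟼ k = ↝-trans (execute↝ 5 _ _ k _) (↝-trans (a⟼ _) (b⟼ k))

join-⟼ : ∀ {a b x z} → a ∶ b ⟼ z → instr 7 a b ∶ x ⟼ ⟨ x , z ⟩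
join-⟼ a⟼ k = ↝-trans (execute↝ 7 _ _ k _) (↝-trans (a⟼ _) (store-⟼ k))

fork-⟼ : ∀ {a b x y z} → a ∶ x ⟼ y → b ∶ x ⟼ z → instr 6 a b ∶ x ⟼ ⟨ y , z ⟩
fork-⟼ a⟼ b⟼ k = ↝-trans (execute↝ 6 _ _ k _) (↝-trans (a⟼ _) (join-⟼ b⟼ k))

data Iterates (a : ℕ) : ℕ → ℕ → ℕ → Set where
  done : ∀ {y} → Iterates a 0 y y
  next : ∀ {n x y z} → a ∶ x ⟼ y → Iterates a n y z → Iterates a (suc n) x z

iter-⟼ : ∀ {t a b n y z} → Iterates a n y z → instr (8 + t) a b ∶ ⟨ n , y ⟩ ⟼ z
iter-⟼ {t} {a} {b} {n} {y} {z} it k = ↝-trans (execute↝ (8 + t) a b k _) (unfold it)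
  where
  unfold : Iterates a n y z →
           loop (fst ⟨ n , y ⟩ ∷ a ∷ b ∷ k ∷ snd ⟨ n , y ⟩ ∷ []) ↝ ⟨ k , z ⟩
  unfold it rewrite fst-pair n y | snd-pair n y with it
  ... | done         = 0 , refl
  -- The reloaded instruction has tag exactly 8, whatever `t` was.
  ... | next a⟼ rest = ↝-trans (a⟼ _) (↝-trans (store-⟼ _) (iter-⟼ {0} rest k))

iterates-total : ∀ {a} → (∀ x → ∃ λ y → a ∶ x ⟼ y) → ∀ n x → ∃ λ z → Iterates a n x z
iterates-total total zero    x = x , done
iterates-total total (suc n) x =
  let (y , a⟼) = total x ; (z , rest) = iterates-total total n y in z , next a⟼ rest

-- Termination of every program

Total : ℕ → Set
Total c = ∀ x → ∃ λ y → c ∶ x ⟼ y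

instr-total : ∀ t a b → (∀ {c} → c < instr t a b → Total c) → Total (instr t a b)
instr-total 0 a b below x = _ , zero-⟼
instr-total (suc t) a b below = go t
  where
  -- Strictness comes from the positive tag. Since `instr 0 0 0` is the number 0, tag 0 has to be an
  -- instruction that runs no operand.
  a+b<c : a + b < instr (suc t) a b
  a+b<c = ≤-trans (s≤s (≤-trans (+≤pair a b) (m≤n+m _ t))) (+≤pair (suc t) ⟨ a , b ⟩)
  a-total : Total a
  a-total = below (≤-<-trans (m≤m+n a b) a+b<c)
  b-total : Total b
  b-total = below (≤-<-trans (m≤n+m b a) a+b<c)
  go : ∀ t → Total (instr (suc t) a b)
  go 0 x = _ , suc-⟼
  go 1 x = _ , fst-⟼
  go 2 x = _ , snd-⟼
  go 3 x = _ , store-⟼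
  go 4 x = let (y , a⟼) = a-total x ; (z , b⟼) = b-total y in z , seq-⟼ a⟼ b⟼
  go 5 x = let (y , a⟼) = a-total x ; (z , b⟼) = b-total x in _ , fork-⟼ a⟼ b⟼
  go 6 x = let (z , a⟼) = a-total b in _ , join-⟼ a⟼
  go (suc (suc (suc (suc (suc (suc (suc t))))))) x with pair-surjective x
  -- The number of rounds `n` is read off the input before the loop starts, so totality of the body
  -- suffices.
  ... | n , y , refl = let (z , it) = iterates-total a-total n y in z , iter-⟼ it

⟼-total : ∀ c → Total c
⟼-total c = go c (<-wellFounded c)
  where
  go : ∀ c → Acc _<_ c → Total c
  go c (acc below) with pair-surjective c
  ... | t , ab , refl with pair-surjective ab
  ...   | a , b , refl = instr-total t a b λ d<c → go _ (below d<c)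

start : ℕ → ℕ → ℕ
start c x = ⟨ c ▹ 0 , x ⟩

steps-halt : ∀ c x → ∃ λ t → fst (steps t (start c x)) ≡ 0
steps-halt c x with ⟼-total c x
... | y , c⟼ = let (t , eq) = c⟼ 0 in t , trans (cong fst eq) (fst-pair 0 y)

stack : Vec ℕ 3 → ℕ
stack (t ∷ c ∷ x ∷ []) = fst (steps t (start c x))

stack-empties : ∀ v → ∃ λ t → stack (t ∷ v) ≡ 0
stack-empties (c ∷ x ∷ []) = steps-halt c x

haltingTime : Vec ℕ 2 → ℕ
haltingTime = minimise stack stack-empties

universal : ℕ → ℕ → ℕ
universal c x = snd (steps (haltingTime (c ∷ x ∷ [])) (start c x))

universal-computable : Computable (bin universal)
universal-computable = computable-resp-≗ (λ { (c ∷ x ∷ []) → refl })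
  (snd° (steps-computable ⊙ haltingTime-computable ∷ᵛ start° (arg 0F) (arg 1F) ∷ᵛ []ᵛ))
  where
  start° : ∀ {n} {a b : Vec ℕ n → ℕ} → Computable a → Computable b → Computable (λ v → start (a v) (b v))
  start° ca cb = pair° (suc° (pair° ca zero°)) cb
  haltingTime-computable : Computable haltingTime
  haltingTime-computable = minimise-computable stack stack-empties
    (computable-resp-≗ (λ { (t ∷ c ∷ x ∷ []) → refl })
      (fst° (steps-computable ⊙ arg 0F ∷ᵛ start° (arg 1F) (arg 2F) ∷ᵛ []ᵛ)))

universal-⟼ : ∀ {c x y} → c ∶ x ⟼ y → universal c x ≡ y
universal-⟼ {c} {x} {y} c⟼ with c⟼ 0
... | t , eq = begin
  snd (steps (haltingTime (c ∷ x ∷ [])) (start c x))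
    ≡⟨ cong snd (halted-unique (haltingTime (c ∷ x ∷ [])) t (start c x) (minimise-zero stack stack-empties (c ∷ x ∷ []))
                               (trans (cong fst eq) (fst-pair 0 y))) ⟩
  snd (steps t (start c x))  ≡⟨ cong snd eq ⟩
  snd ⟨ 0 , y ⟩              ≡⟨ snd-pair 0 y ⟩
  y                          ∎
  where open ≡-Reasoning

-- Compilation of primitive recursive functions

encode : ∀ {n} → Vec ℕ n → ℕ
encode []      = 0
encode (x ∷ v) = ⟨ x , encode v ⟩

infixr 6 _⨾_
_⨾_ fork : ℕ → ℕ → ℕ
c ⨾ d = instr 5 c d
fork  = instr 6

clear succ first second : ℕ
clear  = instr 0 0 0
succ   = instr 1 0 0
first  = instr 2 0 0
second = instr 3 0 0

iter : ℕ → ℕ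
iter c = instr 8 c 0

-- The accumulator of the loop is ⟨ i , ⟨ value at i , parameters ⟩ ⟩.
recBody : ℕ → ℕ
recBody h = fork (first ⨾ succ) (fork h (second ⨾ second))

mutual
  compile : ∀ {n} → PR n → ℕ
  compile zeroᵖ        = clear
  compile succᵖ        = first ⨾ succ
  compile (projᵖ i)    = select i
  compile (compᵖ g hs) = compile* hs ⨾ compile g
  -- The input ⟨ x , v ⟩ becomes the counter `x` with accumulator ⟨ 0 , ⟨ g v , v ⟩ ⟩. An
  -- accumulator is already the encoded argument vector of `h`; at the end `second ⨾ first` extracts
  -- the value.
  compile (recᵖ g h)   =
    fork first (fork clear (fork (second ⨾ compile g) second)) ⨾ iter (recBody (compile h)) ⨾ second ⨾ first

  compile* : ∀ {m n} → Vec (PR n) m → ℕ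
  compile* []       = clear
  compile* (h ∷ hs) = fork (compile h) (compile* hs)

  select : ∀ {n} → Fin n → ℕ
  select zero    = first
  select (suc i) = second ⨾ select i

first-⟼ : ∀ x y → first ∶ ⟨ x , y ⟩ ⟼ x
first-⟼ x y = subst (first ∶ ⟨ x , y ⟩ ⟼_) (fst-pair x y) fst-⟼

second-⟼ : ∀ x y → second ∶ ⟨ x , y ⟩ ⟼ y
second-⟼ x y = subst (second ∶ ⟨ x , y ⟩ ⟼_) (snd-pair x y) snd-⟼

select-⟼ : ∀ {n} (i : Fin n) v → select i ∶ encode v ⟼ lookup v i
select-⟼ zero    (x ∷ v) = first-⟼ x (encode v)
select-⟼ (suc i) (x ∷ v) = seq-⟼ (second-⟼ x (encode v)) (select-⟼ i v)

-- The machine peels rounds off the front, whereas the recursion equation at `suc x` adds a round at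
-- the end.
iterates-snoc : ∀ {a n x y z} → Iterates a n x y → a ∶ y ⟼ z → Iterates a (suc n) x z
iterates-snoc done         b⟼ = next b⟼ done
iterates-snoc (next a⟼ it) b⟼ = next a⟼ (iterates-snoc it b⟼)

mutual
  compile-⟼ : ∀ {n} (p : PR n) v → compile p ∶ encode v ⟼ ⟦ p ⟧ v
  compile-⟼ zeroᵖ        v        = zero-⟼
  compile-⟼ succᵖ        (x ∷ []) = seq-⟼ (first-⟼ x 0) suc-⟼
  compile-⟼ (projᵖ i)    v        = select-⟼ i v
  compile-⟼ (compᵖ g hs) v        = seq-⟼ (compile*-⟼ hs v) (compile-⟼ g (⟦ hs ⟧* v))
  compile-⟼ (recᵖ g h)   (x ∷ v)  =
    seq-⟼ (fork-⟼ (first-⟼ x _)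
             (fork-⟼ zero-⟼ (fork-⟼ (seq-⟼ (second-⟼ x _) (compile-⟼ g v)) (second-⟼ x _))))
    (seq-⟼ (iter-⟼ {0} (recBody-iterates g h x v))
    (seq-⟼ (second-⟼ x _) (first-⟼ _ _)))

  compile*-⟼ : ∀ {m n} (hs : Vec (PR n) m) v → compile* hs ∶ encode v ⟼ encode (⟦ hs ⟧* v)
  compile*-⟼ []       v = zero-⟼
  compile*-⟼ (h ∷ hs) v = fork-⟼ (compile-⟼ h v) (compile*-⟼ hs v)

  recBody-iterates : ∀ {n} (g : PR n) h x v →
    Iterates (recBody (compile h)) x (encode (0 ∷ ⟦ g ⟧ v ∷ v)) (encode (x ∷ ⟦ recᵖ g h ⟧ (x ∷ v) ∷ v))
  recBody-iterates g h zero    v = done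
  recBody-iterates g h (suc x) v = iterates-snoc (recBody-iterates g h x v)
    (fork-⟼ (seq-⟼ (first-⟼ x _) suc-⟼)
      (fork-⟼ (compile-⟼ h (x ∷ ⟦ recᵖ g h ⟧ (x ∷ v) ∷ v)) (seq-⟼ (second-⟼ x _) (second-⟼ _ _))))

universal-compile : ∀ (p : PR 1) x → universal (compile p) ⟨ x , 0 ⟩ ≡ ⟦ p ⟧ (x ∷ [])
universal-compile p x = universal-⟼ (compile-⟼ p (x ∷ []))

-- The diagonal set

diagonal : ℕ → Bool
-- `⟨ n , 0 ⟩` is `encode (n ∷ [])`, the form in which a compiled unary function takes its argument.
diagonal n = universal n ⟨ n , 0 ⟩ ≡ᵇ 0

diagonal-computable : Computable (un λ n → boolToℕ (diagonal n))
diagonal-computable = computable-resp-≗ (λ { (n ∷ []) → refl })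
  (isZero° (universal-computable ⊙ arg 0F ∷ᵛ pair° (arg 0F) zero° ∷ᵛ []ᵛ))

diagonal-compile : ∀ (p : PR 1) → diagonal (compile p) ≡ (⟦ p ⟧ (compile p ∷ []) ≡ᵇ 0)
diagonal-compile p = cong (_≡ᵇ 0) (universal-compile p (compile p))

-- Finite and cofinite sets of natural numbers

odd : ℕ → Bool
odd zero    = false
odd (suc n) = not (odd n)

half : ℕ → ℕ
half zero    = 0
half (suc n) = boolToℕ (odd n) + half n

halves : ℕ → ℕ → ℕ
halves zero    m = m
halves (suc i) m = half (halves i m)

bit : ℕ → ℕ → Bool
bit m i = odd (halves i m)

double-suc : ∀ n → suc n + suc n ≡ suc (suc (n + n))
double-suc n = cong suc (+-suc n n)

odd-half : ∀ n → boolToℕ (odd n) + (half n + half n) ≡ n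
odd-half zero = refl
odd-half (suc n) with odd n | odd-half n
... | true  | eq = trans (double-suc (half n)) (cong suc eq)
... | false | eq = cong suc eq

odd-n+n : ∀ n → odd (n + n) ≡ false
odd-n+n zero    = refl
odd-n+n (suc n) = trans (cong odd (double-suc n)) (cong (λ b → not (not b)) (odd-n+n n))

half-n+n : ∀ n → half (n + n) ≡ n
half-n+n zero = refl
half-n+n (suc n) rewrite +-suc n n | odd-n+n n | half-n+n n = refl

odd-double : ∀ b n → odd (boolToℕ b + (n + n)) ≡ b
odd-double false n = odd-n+n n
odd-double true  n = cong not (odd-n+n n)

half-double : ∀ b n → half (boolToℕ b + (n + n)) ≡ n
half-double false n = half-n+n n
half-double true  n rewrite odd-n+n n = half-n+n n

half≤ : ∀ n → half n ≤ n
half≤ n = subst (half n ≤_) (odd-half n) (≤-trans (m≤m+n _ _) (m≤n+m _ (boolToℕ (odd n))))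

half-suc≤ : ∀ n → half (suc n) ≤ n
half-suc≤ n with odd n | odd-half n
... | false | _  = half≤ n
... | true  | eq = subst (suc (half n) ≤_) eq (s≤s (m≤m+n _ _))

halves-half : ∀ i m → halves i (half m) ≡ halves (suc i) m
halves-half zero    m = refl
halves-half (suc i) m = cong half (halves-half i m)

-- Halving lowers a positive number by at least one. This crude bound is what lets a code serve as
-- the threshold of its own set in `mem-high`.
halves≡0 : ∀ i m → m ≤ i → halves i m ≡ 0
halves≡0 zero    zero    _ = refl
halves≡0 (suc i) zero    _ = cong half (halves≡0 i 0 z≤n)
halves≡0 (suc i) (suc m) (s≤s m≤i) =
  trans (sym (halves-half i (suc m))) (halves≡0 i (half (suc m)) (≤-trans (half-suc≤ m) m≤i))

bit-high : ∀ m i → m ≤ i → bit m i ≡ false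
bit-high m i m≤i = cong odd (halves≡0 i m m≤i)

bit-suc : ∀ m i → bit m (suc i) ≡ bit (half m) i
bit-suc m i = cong odd (sym (halves-half i m))

odd-half-injective : ∀ m n → odd m ≡ odd n → half m ≡ half n → m ≡ n
odd-half-injective m n o h = begin
  m                                    ≡⟨ odd-half m ⟨
  boolToℕ (odd m) + (half m + half m)  ≡⟨ cong₂ (λ b k → boolToℕ b + (k + k)) o h ⟩
  boolToℕ (odd n) + (half n + half n)  ≡⟨ odd-half n ⟩
  n                                    ∎
  where open ≡-Reasoning

-- Induction on a common bound of both numbers, which halving decreases; the lowest digits agree by
-- the hypothesis at 0.
bit-injective : ∀ m n → bit m ≗ bit n → m ≡ n
bit-injective m n = go (m + n) m n (m≤m+n m n) (m≤n+m n m)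
  where
  half-bound : ∀ {m s} → m ≤ suc s → half m ≤ s
  half-bound {zero}  _         = z≤n
  half-bound {suc m} (s≤s m≤s) = ≤-trans (half-suc≤ m) m≤s
  go : ∀ s m n → m ≤ s → n ≤ s → bit m ≗ bit n → m ≡ n
  go zero    zero zero _ _ _ = refl
  go (suc s) m n m≤ n≤ eq = odd-half-injective m n (eq 0)
    (go s (half m) (half n) (half-bound m≤) (half-bound n≤)
      (λ i → trans (sym (bit-suc m i)) (trans (eq (suc i)) (bit-suc n i))))

-- The number x codes the set with characteristic function mem x: the binary expansion of
-- half x, complemented when x is odd.
mem : ℕ → ℕ → Bool
mem x i = odd x xor bit (half x) i

mem-high : ∀ x i → x ≤ i → mem x i ≡ odd x
mem-high x i x≤i = trans (cong (odd x xor_) (bit-high (half x) i (≤-trans (half≤ x) x≤i)))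
                         (Bool.xor-identityʳ (odd x))

xor-cancelˡ : ∀ a {b c} → a xor b ≡ a xor c → b ≡ c
xor-cancelˡ false eq = eq
xor-cancelˡ true  eq = Bool.not-injective eq

-- At the index `x + y`, past both thresholds, each set shows only its parity bit.
mem-odd : ∀ x y → mem x ≗ mem y → odd x ≡ odd y
mem-odd x y eq = trans (sym (mem-high x (x + y) (m≤m+n x y)))
                       (trans (eq (x + y)) (mem-high y (x + y) (m≤n+m y x)))

mem-injective : ∀ x y → mem x ≗ mem y → x ≡ y
mem-injective x y eq = odd-half-injective x y same-odd (bit-injective (half x) (half y) λ i →
  xor-cancelˡ (odd x) (trans (eq i) (cong (_xor bit (half y) i) (sym same-odd))))
  where
  same-odd : odd x ≡ odd y
  same-odd = mem-odd x y eq

-- bits N g i has the binary digits g (N ∸ i), …, g (N ∸ 1), least significant first.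
bits : ℕ → (ℕ → Bool) → ℕ → ℕ
bits N g zero    = 0
bits N g (suc i) = boolToℕ (g (N ∸ suc i)) + (bits N g i + bits N g i)

bit-bits : ∀ N g i j → i ≤ N → j < i → bit (bits N g i) j ≡ g (N ∸ i + j)
bit-bits N g (suc i) zero    i<N _ =
  trans (odd-double (g (N ∸ suc i)) (bits N g i)) (cong g (sym (+-identityʳ _)))
bit-bits N g (suc i) (suc j) i<N (s≤s j<i) = begin
  bit (bits N g (suc i)) (suc j)    ≡⟨ bit-suc (bits N g (suc i)) j ⟩
  bit (half (bits N g (suc i))) j   ≡⟨ cong (λ m → bit m j) (half-double (g (N ∸ suc i)) (bits N g i)) ⟩
  bit (bits N g i) j                ≡⟨ bit-bits N g i j (<⇒≤ i<N) j<i ⟩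
  g (N ∸ i + j)                     ≡⟨ cong (λ m → g (m + j)) (suc-∸ i<N) ⟨
  g (suc (N ∸ suc i) + j)           ≡⟨ cong g (+-suc (N ∸ suc i) j) ⟨
  g (N ∸ suc i + suc j)             ∎
  where
  open ≡-Reasoning
  suc-∸ : ∀ {i N} → i < N → suc (N ∸ suc i) ≡ N ∸ i
  suc-∸ i<N = sym (+-∸-assoc 1 i<N)

bit-bits-high : ∀ N g i j → i ≤ j → bit (bits N g i) j ≡ false
bit-bits-high N g zero    j       _         = bit-high 0 j z≤n
bit-bits-high N g (suc i) (suc j) (s≤s i≤j) =
  trans (bit-suc (bits N g (suc i)) j)
    (trans (cong (λ m → bit m j) (half-double (g (N ∸ suc i)) (bits N g i))) (bit-bits-high N g i j i≤j))

-- Inverse to `mem`: `b` is the value taken from the threshold `N` on, and the digits are stored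
-- relative to `b` because `mem` complements odd codes.
build : Bool → ℕ → (ℕ → Bool) → ℕ
build b N g = boolToℕ b + (m + m)
  where
  m : ℕ
  m = bits N (λ i → b xor g i) N

odd-build : ∀ b N g → odd (build b N g) ≡ b
odd-build b N g = odd-double b (bits N (λ i → b xor g i) N)

mem-build : ∀ b N g → (∀ i → N ≤ i → g i ≡ b) → mem (build b N g) ≗ g
mem-build b N g stable i
  rewrite odd-build b N g | half-double b (bits N (λ j → b xor g j) N) with <-≤-connex i N
... | inj₁ i<N rewrite bit-bits N (λ j → b xor g j) N i ≤-refl i<N | n∸n≡0 N = xor-involutive b (g i)
  where
  xor-involutive : ∀ a c → a xor (a xor c) ≡ c
  xor-involutive true  c = Bool.not-involutive c
  xor-involutive false c = refl
... | inj₂ N≤i rewrite bit-bits-high N (λ j → b xor g j) N i N≤i | stable i N≤i = Bool.xor-identityʳ b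

-- Bounded existential quantification

any< : ℕ → (ℕ → Bool) → Bool
any< zero    g = false
any< (suc N) g = g N ∨ any< N g

any<-cong : ∀ N {g g′} → g ≗ g′ → any< N g ≡ any< N g′
any<-cong zero    eq = refl
any<-cong (suc N) eq = cong₂ _∨_ (eq N) (any<-cong N eq)

any<-∨ : ∀ N g g′ → any< N (λ i → g i ∨ g′ i) ≡ any< N g ∨ any< N g′
any<-∨ zero    g g′ = refl
any<-∨ (suc N) g g′ rewrite any<-∨ N g g′ with g N | g′ N
... | true  | _     = refl
... | false | false = refl
... | false | true  = sym (Bool.∨-zeroʳ _)

any<-stable : ∀ M N g → (∀ i → M ≤ i → g i ≡ false) → any< (N + M) g ≡ any< M g
any<-stable M zero    g high = refl
any<-stable M (suc N) g high rewrite high (N + M) (m≤n+m M N) = any<-stable M N g high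

any<-true : ∀ N g i → i < N → g i ≡ true → any< N g ≡ true
any<-true (suc N) g i (s≤s i≤N) gi≡true with m≤n⇒m<n∨m≡n i≤N
... | inj₁ i<N  = trans (cong (g N ∨_) (any<-true N g i i<N gi≡true)) (Bool.∨-zeroʳ (g N))
... | inj₂ refl = cong (_∨ any< N g) gi≡true

any<-false : ∀ N g → (∀ i → g i ≡ false) → any< N g ≡ false
any<-false zero    g none = refl
any<-false (suc N) g none = cong₂ _∨_ (none N) (any<-false N g none)

≡ᵇ-refl : ∀ n → (n ≡ᵇ n) ≡ true
≡ᵇ-refl zero    = refl
≡ᵇ-refl (suc n) = ≡ᵇ-refl n

≡ᵇ-false : ∀ m n → m ≢ n → (m ≡ᵇ n) ≡ false
≡ᵇ-false zero    zero    m≢n = contradiction refl m≢n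
≡ᵇ-false zero    (suc n) m≢n = refl
≡ᵇ-false (suc m) zero    m≢n = refl
≡ᵇ-false (suc m) (suc n) m≢n = ≡ᵇ-false m n (λ m≡n → m≢n (cong suc m≡n))

any<-≡ᵇ : ∀ N n (g : ℕ → Bool) → n < N → any< N (λ i → (i ≡ᵇ n) ∧ g i) ≡ g n
any<-≡ᵇ N n g n<N with g n in eq
... | true  = any<-true N _ n n<N (cong₂ _∧_ (≡ᵇ-refl n) eq)
... | false = any<-false N _ none
  where
  none : ∀ i → (i ≡ᵇ n) ∧ g i ≡ false
  none i with i ≟ n
  ... | yes refl = trans (cong ((n ≡ᵇ n) ∧_) eq) (Bool.∧-zeroʳ _)
  ... | no i≢n   = cong (_∧ g i) (≡ᵇ-false i n i≢n)

-- Computability of membership, coding and bounded search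

odd-computable : Computable (un λ x → boolToℕ (odd x))
odd-computable = primrec zero° (isZero° (arg 1F)) (λ { [] → refl }) (λ { x [] → not-≡ᵇ (odd x) })
  where
  not-≡ᵇ : ∀ b → boolToℕ (boolToℕ b ≡ᵇ 0) ≡ boolToℕ (not b)
  not-≡ᵇ true  = refl
  not-≡ᵇ false = refl

half-computable : Computable (un half)
half-computable = primrec zero° ((odd-computable ⊙ arg 0F ∷ᵛ []ᵛ) +° arg 1F) (λ { [] → refl }) (λ { x [] → refl })

halves-computable : Computable (bin halves)
halves-computable = primrec (arg 0F) (half-computable ⊙ arg 1F ∷ᵛ []ᵛ) (λ { (m ∷ []) → refl }) (λ { i (m ∷ []) → refl })

module _ {n : ℕ} where

  odd° : {a : Vec ℕ n → ℕ} → Computable a → ComputableBool (λ v → odd (a v))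
  odd° ca = odd-computable ⊙ ca ∷ᵛ []ᵛ

  mem° : {a i : Vec ℕ n → ℕ} → Computable a → Computable i → ComputableBool (λ v → mem (a v) (i v))
  mem° ca ci = zip° _xor_ (odd° ca) (odd° (halves-computable ⊙ ci ∷ᵛ (half-computable ⊙ ca ∷ᵛ []ᵛ) ∷ᵛ []ᵛ))

  build° : {b : Vec ℕ n → Bool} {N : Vec ℕ n → ℕ} (g : Vec ℕ n → ℕ → Bool) →
           ComputableBool b → Computable N → ComputableBool (λ w → g (tail w) (head w)) →
           Computable (λ v → build (b v) (N v) (g v))
  build° {b} {N} g cb cN cg = cb +° (cbits +° cbits)
    where
    F : Vec ℕ (suc n) → ℕ
    F w = bits (N (tail w)) (λ j → b (tail w) xor g (tail w) j) (head w)
    F-computable : Computable F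
    F-computable = primrec zero°
      (zip° _xor_ (cb ⊙ args₂) (cg ⊙ ((cN ⊙ args₂) ∸° suc° (arg 0F)) ∷ᵛ args₂) +° (arg 1F +° arg 1F))
      (λ _ → refl) (λ _ _ → refl)
    cbits : Computable (λ v → bits (N v) (λ j → b v xor g v j) (N v))
    cbits = F-computable ⊙ cN ∷ᵛ args₀

  any<° : {N : Vec ℕ n → ℕ} (g : Vec ℕ n → ℕ → Bool) →
          Computable N → ComputableBool (λ w → g (tail w) (head w)) →
          ComputableBool (λ v → any< (N v) (g v))
  any<° {N} g cN cg = F-computable ⊙ cN ∷ᵛ args₀
    where
    F : Vec ℕ (suc n) → ℕ
    F w = boolToℕ (any< (head w) (g (tail w)))
    ∨-if : ∀ p q → (if p then 1 else boolToℕ q) ≡ boolToℕ (p ∨ q)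
    ∨-if true  q = refl
    ∨-if false q = refl
    F-computable : Computable F
    F-computable = primrec zero° (if° (cg ⊙ arg 0F ∷ᵛ args₂) (const° 1) (arg 1F))
      (λ _ → refl) (λ i v → ∨-if (g v i) (any< i (g v)))

-- Boolean operations on codes

cup cap : ℕ → ℕ → ℕ
cup x y = build (odd x ∨ odd y) (x + y) (λ i → mem x i ∨ mem y i)
cap x y = build (odd x ∧ odd y) (x + y) (λ i → mem x i ∧ mem y i)

cmp : ℕ → ℕ
cmp x = build (not (odd x)) x (λ i → not (mem x i))

-- The bound `x + y` lies past the thresholds of both operands, where each is constant.
mem-cup : ∀ x y → mem (cup x y) ≗ λ i → mem x i ∨ mem y i
mem-cup x y = mem-build _ (x + y) _ λ i x+y≤i →
  cong₂ _∨_ (mem-high x i (m+n≤o⇒m≤o x x+y≤i)) (mem-high y i (m+n≤o⇒n≤o x x+y≤i))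

mem-cap : ∀ x y → mem (cap x y) ≗ λ i → mem x i ∧ mem y i
mem-cap x y = mem-build _ (x + y) _ λ i x+y≤i →
  cong₂ _∧_ (mem-high x i (m+n≤o⇒m≤o x x+y≤i)) (mem-high y i (m+n≤o⇒n≤o x x+y≤i))

mem-cmp : ∀ x → mem (cmp x) ≗ λ i → not (mem x i)
mem-cmp x = mem-build _ x _ λ i x≤i → cong not (mem-high x i x≤i)

mem-empty : ∀ i → mem 0 i ≡ false
mem-empty i = mem-high 0 i z≤n

mem-full : ∀ i → mem 1 i ≡ true
mem-full i = cong not (bit-high 0 i z≤n)

cup-computable : Computable (bin cup)
cup-computable = computable-resp-≗ (λ { (x ∷ y ∷ []) → refl })
  (build° (λ v i → mem (lookup v 0F) i ∨ mem (lookup v 1F) i)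
    (zip° _∨_ (odd° (arg 0F)) (odd° (arg 1F))) (arg 0F +° arg 1F)
    (computable-resp-≗ (λ { (i ∷ x ∷ y ∷ []) → refl })
      (zip° _∨_ (mem° (arg 1F) (arg 0F)) (mem° (arg 2F) (arg 0F)))))

cap-computable : Computable (bin cap)
cap-computable = computable-resp-≗ (λ { (x ∷ y ∷ []) → refl })
  (build° (λ v i → mem (lookup v 0F) i ∧ mem (lookup v 1F) i)
    (zip° _∧_ (odd° (arg 0F)) (odd° (arg 1F))) (arg 0F +° arg 1F)
    (computable-resp-≗ (λ { (i ∷ x ∷ y ∷ []) → refl })
      (zip° _∧_ (mem° (arg 1F) (arg 0F)) (mem° (arg 2F) (arg 0F)))))

cmp-computable : Computable (un cmp)
cmp-computable = computable-resp-≗ (λ { (x ∷ []) → refl })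
  (build° (λ v i → not (mem (lookup v 0F) i)) (map° not (odd° (arg 0F))) (arg 0F)
    (computable-resp-≗ (λ { (i ∷ x ∷ []) → refl }) (map° not (mem° (arg 1F) (arg 0F)))))

-- The modality attached to a set S of natural numbers

module Modality (S : ℕ → Bool) where

  -- The elements of a finite set lie below its code, so the search up to `x` is exhaustive.
  meets : ℕ → Bool
  meets x = odd x ∨ any< x (λ n → mem x (suc n) ∧ S n)

  shifted : ℕ → ℕ → Bool
  shifted x 0             = false
  shifted x 1             = mem x 0 ∨ meets x
  shifted x (suc (suc i)) = mem x (suc i)

  modality : ℕ → ℕ
  -- Past `2 + x` only the shift clause of `shifted` applies, and there `mem x` has settled.
  modality x = build (odd x) (2 + x) (shifted x)

  mem-modality : ∀ x → mem (modality x) ≗ shifted x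
  mem-modality x = mem-build _ (2 + x) (shifted x) λ
    { (suc (suc i)) (s≤s (s≤s x≤i)) → mem-high x (suc i) (m≤n⇒m≤1+n x≤i) }

  -- The slack `N` lets searches through different sets be compared under one bound.
  meets-finite : ∀ N x → odd x ≡ false → meets x ≡ any< (N + x) (λ n → mem x (suc n) ∧ S n)
  meets-finite N x finite = trans (cong (_∨ any< x (λ n → mem x (suc n) ∧ S n)) finite)
    (sym (any<-stable x N _ λ i x≤i →
      cong (_∧ S i) (trans (mem-high x (suc i) (m≤n⇒m≤1+n x≤i)) finite)))

  meets-cofinite : ∀ x → odd x ≡ true → meets x ≡ true
  meets-cofinite x cofinite = cong (_∨ any< x (λ n → mem x (suc n) ∧ S n)) cofinite

  odd-cup : ∀ x y → odd (cup x y) ≡ odd x ∨ odd y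
  odd-cup x y = odd-build (odd x ∨ odd y) (x + y) _

  meets-cup : ∀ x y → meets (cup x y) ≡ meets x ∨ meets y
  meets-cup x y = by-cases (odd x) (odd y) refl refl
    where
    open ≡-Reasoning
    by-cases : ∀ p q → odd x ≡ p → odd y ≡ q → meets (cup x y) ≡ meets x ∨ meets y
    by-cases true q ox oy = trans
      (meets-cofinite (cup x y) (trans (odd-cup x y) (cong (_∨ odd y) ox)))
      (sym (cong (_∨ meets y) (meets-cofinite x ox)))
    by-cases false true ox oy = trans
      (meets-cofinite (cup x y) (trans (odd-cup x y) (cong₂ _∨_ ox oy)))
      (sym (trans (cong (meets x ∨_) (meets-cofinite y oy)) (Bool.∨-zeroʳ (meets x))))
    -- Only for two finite sets are searches compared; `x + y + cup x y` exceeds all three codes'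
    -- own bounds, and each search is stretched to it.
    by-cases false false ox oy = begin
      meets (cup x y)
        ≡⟨ meets-finite (x + y) (cup x y) (trans (odd-cup x y) (cong₂ _∨_ ox oy)) ⟩
      any< (x + y + cup x y) (λ n → mem (cup x y) (suc n) ∧ S n)
        ≡⟨ any<-cong (x + y + cup x y) (λ n →
             trans (cong (_∧ S n) (mem-cup x y (suc n))) (Bool.∧-distribʳ-∨ (S n) (mem x (suc n)) _)) ⟩
      any< (x + y + cup x y) (λ n → mem x (suc n) ∧ S n ∨ mem y (suc n) ∧ S n)
        ≡⟨ any<-∨ (x + y + cup x y) _ _ ⟩
      any< (x + y + cup x y) (λ n → mem x (suc n) ∧ S n) ∨ any< (x + y + cup x y) (λ n → mem y (suc n) ∧ S n)
        ≡⟨ cong₂ _∨_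
             (trans (cong (λ N → any< N (λ n → mem x (suc n) ∧ S n)) (rotate x y))
                    (sym (meets-finite (y + cup x y) x ox)))
             (trans (cong (λ N → any< N (λ n → mem y (suc n) ∧ S n))
                          (trans (cong (_+ cup x y) (+-comm x y)) (rotate y x)))
                    (sym (meets-finite (x + cup x y) y oy))) ⟩
      meets x ∨ meets y ∎
      where
      rotate : ∀ a b {c} → a + b + c ≡ b + c + a
      rotate a b {c} = trans (+-assoc a b c) (+-comm a (b + c))

  meets-singleton : ∀ n x → mem x ≗ (_≡ᵇ suc n) → meets x ≡ S n
  meets-singleton n x x≗ = begin
    meets x                                              ≡⟨ meets-finite (suc n) x finite ⟩
    any< (suc n + x) (λ i → mem x (suc i) ∧ S i)         ≡⟨ any<-cong (suc n + x) (λ i → cong (_∧ S i) (x≗ (suc i))) ⟩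
    any< (suc n + x) (λ i → (i ≡ᵇ n) ∧ S i)              ≡⟨ any<-≡ᵇ (suc n + x) n S (m≤m+n (suc n) x) ⟩
    S n                                                  ∎
    where
    open ≡-Reasoning
    -- The index `suc (suc n) + x` is past the threshold `x` and differs from the sole element
    -- `suc n`, so it reveals the parity bit.
    finite : odd x ≡ false
    finite = begin
      odd x                       ≡⟨ mem-high x (suc (suc n) + x) (m≤n+m x _) ⟨
      mem x (suc (suc n) + x)     ≡⟨ x≗ (suc (suc n) + x) ⟩
      (suc (n + x) ≡ᵇ n)          ≡⟨ ≡ᵇ-false (suc (n + x)) n (λ eq → m≢1+m+n n (sym eq)) ⟩
      false                       ∎

  modality-cup : ∀ x y → modality (cup x y) ≡ cup (modality x) (modality y)
  modality-cup x y = mem-injective _ _ λ i → begin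
    mem (modality (cup x y)) i                     ≡⟨ mem-modality (cup x y) i ⟩
    shifted (cup x y) i                            ≡⟨ shifted-cup i ⟩
    shifted x i ∨ shifted y i                      ≡⟨ cong₂ _∨_ (mem-modality x i) (mem-modality y i) ⟨
    mem (modality x) i ∨ mem (modality y) i        ≡⟨ mem-cup (modality x) (modality y) i ⟨
    mem (cup (modality x) (modality y)) i          ∎
    where
    open ≡-Reasoning
    ∨-interchange : ∀ a b c d → (a ∨ b) ∨ (c ∨ d) ≡ (a ∨ c) ∨ (b ∨ d)
    ∨-interchange true  _     _     _ = refl
    ∨-interchange false true  c     _ = sym (Bool.∨-zeroʳ c)
    ∨-interchange false false c     d = refl
    shifted-cup : ∀ i → shifted (cup x y) i ≡ shifted x i ∨ shifted y i
    shifted-cup 0             = refl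
    shifted-cup 1             = trans (cong₂ _∨_ (mem-cup x y 0) (meets-cup x y))
                                      (∨-interchange (mem x 0) (mem y 0) (meets x) (meets y))
    shifted-cup (suc (suc i)) = mem-cup x y (suc i)

  modality-empty : modality 0 ≡ 0
  modality-empty = mem-injective _ _ λ i → trans (mem-modality 0 i) (trans (shifted-empty i) (sym (mem-empty i)))
    where
    shifted-empty : ∀ i → shifted 0 i ≡ false
    shifted-empty 0             = refl
    shifted-empty 1             = refl
    shifted-empty (suc (suc i)) = mem-empty (suc i)

  modality-computable : Computable (un λ n → boolToℕ (S n)) → Computable (un modality)
  modality-computable cS = computable-resp-≗ (λ { (x ∷ []) → refl })
    (build° (λ v → shifted (head v)) (odd° (arg 0F)) (const° 2 +° arg 0F)
      (computable-resp-≗ (λ { (i ∷ x ∷ []) → refl }) shifted-computable))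
    where
    meets-computable : Computable (un λ x → boolToℕ (meets x))
    meets-computable = computable-resp-≗ (λ { (x ∷ []) → refl })
      (zip° _∨_ (odd° (arg 0F))
        (any<° (λ v n → mem (lookup v 0F) (suc n) ∧ S n) (arg 0F)
          (computable-resp-≗ (λ { (n ∷ x ∷ []) → refl })
            (zip° _∧_ (mem° (arg 1F) (suc° (arg 0F))) (cS ⊙ arg 0F ∷ᵛ []ᵛ)))))
    shifted-computable : Computable (bin λ i x → boolToℕ (shifted x i))
    shifted-computable = caseℕ (computable-resp-≗ (λ { (x ∷ []) → refl }) zero°)
      (caseℕ (computable-resp-≗ (λ { (x ∷ []) → refl })
                (zip° _∨_ (mem° (arg 0F) zero°) (meets-computable ⊙ arg 0F ∷ᵛ []ᵛ)))
             (computable-resp-≗ (λ { (i ∷ x ∷ []) → refl }) (mem° (arg 1F) (suc° (arg 0F)))))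

  presentation : ℕPresentation
  presentation = record
    { dom = λ _ → true
    ; cup = cup ; cap = cap ; cmp = cmp ; zer = 0 ; one = 1 ; mod = modality
    ; cup-cl = λ _ _ _ _ → refl ; cap-cl = λ _ _ _ _ → refl ; cmp-cl = λ _ _ → refl
    ; zer-cl = refl ; one-cl = refl ; mod-cl = λ _ _ → refl
    }

  open ℕPresentation presentation using (Dom; ops)

  -- Elements described by characteristic functions

  infix 4 _≐_
  record _≐_ (a : Dom) (g : ℕ → Bool) : Set where
    constructor characteristic
    field mem-≡ : mem (proj₁ a) ≗ g

  open _≐_ public

  -- Codes of sets are unique, so each law of the algebra reduces to the same law of `Bool` at every
  -- `i`.
  ≐-≡ : ∀ {a b : Dom} {g h} → a ≐ g → b ≐ h → g ≗ h → a ≡ b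
  ≐-≡ {x , refl} {y , refl} a≐g b≐h g≗h =
    cong (_, refl) (mem-injective x y λ i → trans (mem-≡ a≐g i) (trans (g≗h i) (sym (mem-≡ b≐h i))))

  open MAOps ops

  var : ∀ a → a ≐ mem (proj₁ a)
  var a = characteristic λ i → refl

  𝟎≐ : 𝟎 ≐ λ _ → false
  𝟎≐ = characteristic mem-empty

  𝟏≐ : 𝟏 ≐ λ _ → true
  𝟏≐ = characteristic mem-full

  f≐ : ∀ a → f a ≐ shifted (proj₁ a)
  f≐ (x , _) = characteristic (mem-modality x)

  infixr 6 _∪≐_
  infixr 7 _∩≐_
  _∪≐_ : ∀ {a b : Dom} {g h} → a ≐ g → b ≐ h → a ∪ b ≐ λ i → g i ∨ h i
  _∪≐_ {x , _} {y , _} a≐g b≐h = characteristic λ i →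
    trans (mem-cup x y i) (cong₂ _∨_ (mem-≡ a≐g i) (mem-≡ b≐h i))

  _∩≐_ : ∀ {a b : Dom} {g h} → a ≐ g → b ≐ h → a ∩ b ≐ λ i → g i ∧ h i
  _∩≐_ {x , _} {y , _} a≐g b≐h = characteristic λ i →
    trans (mem-cap x y i) (cong₂ _∧_ (mem-≡ a≐g i) (mem-≡ b≐h i))

  C≐ : ∀ {a : Dom} {g} → a ≐ g → C a ≐ λ i → not (g i)
  C≐ {x , _} a≐g = characteristic λ i → trans (mem-cmp x i) (cong not (mem-≡ a≐g i))

  ≐-resp-≗ : ∀ {a : Dom} {g h} → g ≗ h → a ≐ g → a ≐ h
  ≐-resp-≗ g≗h a≐g = characteristic λ i → trans (mem-≡ a≐g i) (g≗h i)

  isBooleanAlgebra : IsBooleanAlgebra {A = Dom} _≡_ _∪_ _∩_ C 𝟏 𝟎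
  isBooleanAlgebra = record
    { isDistributiveLattice = record
      { isLattice = record
        { isEquivalence = isEquivalence
        ; ∨-comm  = λ a b → ≐-≡ (var a ∪≐ var b) (var b ∪≐ var a) λ i → Bool.∨-comm (mem (proj₁ a) i) _
        ; ∨-assoc = λ a b c → ≐-≡ ((var a ∪≐ var b) ∪≐ var c) (var a ∪≐ (var b ∪≐ var c))
                                λ i → Bool.∨-assoc (mem (proj₁ a) i) _ _
        ; ∨-cong  = cong₂ _∪_
        ; ∧-comm  = λ a b → ≐-≡ (var a ∩≐ var b) (var b ∩≐ var a) λ i → Bool.∧-comm (mem (proj₁ a) i) _
        ; ∧-assoc = λ a b c → ≐-≡ ((var a ∩≐ var b) ∩≐ var c) (var a ∩≐ (var b ∩≐ var c))
                                λ i → Bool.∧-assoc (mem (proj₁ a) i) _ _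
        ; ∧-cong  = cong₂ _∩_
        ; absorptive =
            (λ a b → ≐-≡ (var a ∪≐ (var a ∩≐ var b)) (var a) λ i → proj₁ Bool.∨-∧-absorptive (mem (proj₁ a) i) _) ,
            (λ a b → ≐-≡ (var a ∩≐ (var a ∪≐ var b)) (var a) λ i → proj₂ Bool.∨-∧-absorptive (mem (proj₁ a) i) _)
        }
      ; ∨-distrib-∧ =
          (λ a b c → ≐-≡ (var a ∪≐ (var b ∩≐ var c)) ((var a ∪≐ var b) ∩≐ (var a ∪≐ var c))
                       λ i → Bool.∨-distribˡ-∧ (mem (proj₁ a) i) _ _) ,
          (λ a b c → ≐-≡ ((var b ∩≐ var c) ∪≐ var a) ((var b ∪≐ var a) ∩≐ (var c ∪≐ var a))
                       λ i → Bool.∨-distribʳ-∧ (mem (proj₁ a) i) (mem (proj₁ b) i) _)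
      ; ∧-distrib-∨ =
          (λ a b c → ≐-≡ (var a ∩≐ (var b ∪≐ var c)) ((var a ∩≐ var b) ∪≐ (var a ∩≐ var c))
                       λ i → Bool.∧-distribˡ-∨ (mem (proj₁ a) i) _ _) ,
          (λ a b c → ≐-≡ ((var b ∪≐ var c) ∩≐ var a) ((var b ∩≐ var a) ∪≐ (var c ∩≐ var a))
                       λ i → Bool.∧-distribʳ-∨ (mem (proj₁ a) i) (mem (proj₁ b) i) _)
      }
    ; ∨-complement =
        (λ a → ≐-≡ (C≐ (var a) ∪≐ var a) 𝟏≐ λ i → Bool.∨-inverseˡ (mem (proj₁ a) i)) ,
        (λ a → ≐-≡ (var a ∪≐ C≐ (var a)) 𝟏≐ λ i → Bool.∨-inverseʳ (mem (proj₁ a) i))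
    ; ∧-complement =
        (λ a → ≐-≡ (C≐ (var a) ∩≐ var a) 𝟎≐ λ i → Bool.∧-inverseˡ (mem (proj₁ a) i)) ,
        (λ a → ≐-≡ (var a ∩≐ C≐ (var a)) 𝟎≐ λ i → Bool.∧-inverseʳ (mem (proj₁ a) i))
    ; ¬-cong = cong C
    }

  isModalAlgebra : IsModalAlgebra ops
  isModalAlgebra = isBooleanAlgebra
    , (λ { (x , _) (y , _) → cong (_, refl) (modality-cup x y) })
    , cong (_, refl) modality-empty

  isComputable : Computable (un λ n → boolToℕ (S n)) → IsComputable presentation
  isComputable cS = computable-resp-≗ (λ { (x ∷ []) → refl }) (const° 1)
    , cup-computable , cap-computable , cmp-computable , modality-computable cS

-- The set S as seen by closed terms

module ClosedTerms {A : Set} (M : MAOps A) where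
  open MAOps M

  base : A
  base = f (C (f 𝟏))

  point : ℕ → A
  point zero    = base
  point (suc n) = f (point n) ∩ C base

  probe : ℕ → A
  probe n = f (point n) ∩ base

module _ {A B : Set} {M : MAOps A} {N : MAOps B} (iso : M ≅ N) where
  open _≅_ iso
  private
    module M = ClosedTerms M
    module N = ClosedTerms N

  ≅-base : h M.base ≡ N.base
  ≅-base = trans (h-f _) (cong (MAOps.f N)
    (trans (h-C _) (cong (MAOps.C N) (trans (h-f _) (cong (MAOps.f N) h-𝟏)))))

  ≅-point : ∀ n → h (M.point n) ≡ N.point n
  ≅-point zero    = ≅-base
  ≅-point (suc n) = trans (h-∩ _ _) (cong₂ (MAOps._∩_ N)
    (trans (h-f _) (cong (MAOps.f N) (≅-point n))) (trans (h-C _) (cong (MAOps.C N) ≅-base)))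

  ≅-probe : ∀ n → h (M.probe n) ≡ N.probe n
  ≅-probe n = trans (h-∩ _ _) (cong₂ (MAOps._∩_ N) (trans (h-f _) (cong (MAOps.f N) (≅-point n))) ≅-base)

module _ (S : ℕ → Bool) where
  open Modality S
  open ℕPresentation presentation using (Dom; ops)
  open MAOps ops
  open ClosedTerms ops

  origin-≐ : C (f 𝟏) ≐ (_≡ᵇ 0)
  origin-≐ = ≐-resp-≗ not-shifted-full (C≐ (f≐ 𝟏))
    where
    not-shifted-full : ∀ i → not (shifted 1 i) ≡ (i ≡ᵇ 0)
    not-shifted-full 0             = refl
    not-shifted-full 1             = refl
    not-shifted-full (suc (suc i)) = cong not (mem-full (suc i))

  base-≐ : base ≐ (_≡ᵇ 1)
  base-≐ = ≐-resp-≗ shifted-origin (f≐ (C (f 𝟏)))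
    where
    shifted-origin : ∀ i → shifted (proj₁ (C (f 𝟏))) i ≡ (i ≡ᵇ 1)
    shifted-origin 0             = refl
    -- Since 0 is a member, its successor 1 is in the image for every `S`.
    shifted-origin 1             = cong (_∨ meets (proj₁ (C (f 𝟏)))) (mem-≡ origin-≐ 0)
    shifted-origin (suc (suc i)) = mem-≡ origin-≐ (suc i)

  -- As 0 is not in `a`, the shift contributes nothing at position 1, which therefore shows `S n`
  -- alone.
  f-singleton-≐ : ∀ {n a} → a ≐ (_≡ᵇ suc n) → f a ≐ λ i → (i ≡ᵇ 1) ∧ S n ∨ (i ≡ᵇ suc (suc n))
  f-singleton-≐ {n} {a} a≐ = ≐-resp-≗ shifted-singleton (f≐ a)
    where
    shifted-singleton : ∀ i → shifted (proj₁ a) i ≡ (i ≡ᵇ 1) ∧ S n ∨ (i ≡ᵇ suc (suc n))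
    shifted-singleton 0             = refl
    shifted-singleton 1             =
      trans (cong₂ _∨_ (mem-≡ a≐ 0) (meets-singleton n (proj₁ a) (mem-≡ a≐))) (sym (Bool.∨-identityʳ (S n)))
    shifted-singleton (suc (suc i)) = mem-≡ a≐ (suc i)

  point-≐ : ∀ n → point n ≐ (_≡ᵇ suc n)
  point-≐ zero    = base-≐
  point-≐ (suc n) = ≐-resp-≗ remove (f-singleton-≐ (point-≐ n) ∩≐ C≐ base-≐)
    where
    remove : ∀ i → ((i ≡ᵇ 1) ∧ S n ∨ (i ≡ᵇ suc (suc n))) ∧ not (i ≡ᵇ 1) ≡ (i ≡ᵇ suc (suc n))
    remove 0             = refl
    remove 1             = Bool.∧-zeroʳ _
    remove (suc (suc i)) = Bool.∧-identityʳ _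

  probe-≐ : ∀ n → probe n ≐ λ i → (i ≡ᵇ 1) ∧ S n
  probe-≐ n = ≐-resp-≗ keep (f-singleton-≐ (point-≐ n) ∩≐ base-≐)
    where
    keep : ∀ i → ((i ≡ᵇ 1) ∧ S n ∨ (i ≡ᵇ suc (suc n))) ∧ (i ≡ᵇ 1) ≡ (i ≡ᵇ 1) ∧ S n
    keep 0             = refl
    keep 1             = trans (Bool.∧-identityʳ _) (Bool.∨-identityʳ (S n))
    keep (suc (suc i)) = Bool.∧-zeroʳ _

  probe-empty : ∀ n → S n ≡ false → probe n ≡ 𝟎
  probe-empty n n∉S = ≐-≡ (probe-≐ n) 𝟎≐ λ i →
    trans (cong ((i ≡ᵇ 1) ∧_) n∉S) (Bool.∧-zeroʳ _)

  probe-nonempty : ∀ n → S n ≡ true → probe n ≢ 𝟎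
  probe-nonempty n n∈S eq = contradiction
    (trans (sym n∈S) (trans (sym (mem-≡ (probe-≐ n) 1)) (cong (λ a → mem (proj₁ a) 1) eq))) λ ()

  -- Isomorphisms preserve closed terms; for `n` in `S`, injectivity of `h` keeps the probe
  -- different from zero.
  copy-decides : ∀ {Q : MAOps ℕ} → ops ≅ Q → ∀ n → (ClosedTerms.probe Q n ≡ᵇ MAOps.𝟎 Q) ≡ not (S n)
  copy-decides {Q} iso n with S n in eq
  ... | false = trans (cong (_≡ᵇ MAOps.𝟎 Q)
                        (trans (sym (≅-probe iso n)) (trans (cong h (probe-empty n eq)) h-𝟎)))
                      (≡ᵇ-refl (MAOps.𝟎 Q))
    where open _≅_ iso
  ... | true  = ≡ᵇ-false _ _ λ probe≡𝟎 → probe-nonempty n eq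
                  (proj₁ h-bij (trans (≅-probe iso n) (trans probe≡𝟎 (sym h-𝟎))))
    where open _≅_ iso

-- Deciding S primitive recursively in a punctual copy

constᵖ : ∀ {n} → ℕ → PR n
constᵖ zero    = zeroᵖ
constᵖ (suc k) = compᵖ succᵖ (constᵖ k ∷ [])

⟦constᵖ⟧ : ∀ {n} k (v : Vec ℕ n) → ⟦ constᵖ k ⟧ v ≡ k
⟦constᵖ⟧ zero    v = refl
⟦constᵖ⟧ (suc k) v = cong suc (⟦constᵖ⟧ k v)

-- The zero of a copy is a fixed number, so the comparison can be built by recursion on it outside
-- the program. Each layer strips one successor; output 0 means equal.
differsᵖ : ℕ → PR 1
differsᵖ zero    = projᵖ 0F
differsᵖ (suc z) = recᵖ (constᵖ 1) (compᵖ (differsᵖ z) (projᵖ 0F ∷ []))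

differsᵖ-≡ᵇ : ∀ z x → (⟦ differsᵖ z ⟧ (x ∷ []) ≡ᵇ 0) ≡ (x ≡ᵇ z)
differsᵖ-≡ᵇ zero    x       = refl
differsᵖ-≡ᵇ (suc z) zero    = refl
differsᵖ-≡ᵇ (suc z) (suc x) = differsᵖ-≡ᵇ z x

-- In a given copy `base` and `C base` are single numbers and enter the program as constants.
probe-primRec : ∀ {Q : MAOps ℕ} → IsPunctual Q → PrimRec (un (ClosedTerms.probe Q))
probe-primRec {Q} (_ , (∩ᵖ , ⟦∩ᵖ⟧) , _ , (fᵖ , ⟦fᵖ⟧)) = probeᵖ , λ { (n ∷ []) → ⟦probeᵖ⟧ n }
  where
  open MAOps Q
  open ClosedTerms Q
  pointᵖ probeᵖ : PR 1
  pointᵖ = recᵖ (constᵖ base) (compᵖ ∩ᵖ (compᵖ fᵖ (projᵖ 1F ∷ []) ∷ constᵖ (C base) ∷ []))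
  probeᵖ = compᵖ ∩ᵖ (compᵖ fᵖ (pointᵖ ∷ []) ∷ constᵖ base ∷ [])
  ⟦pointᵖ⟧ : ∀ n → ⟦ pointᵖ ⟧ (n ∷ []) ≡ point n
  ⟦pointᵖ⟧ zero    = ⟦constᵖ⟧ base []
  ⟦pointᵖ⟧ (suc n) = trans (⟦∩ᵖ⟧ _) (cong₂ _∩_
    (trans (⟦fᵖ⟧ _) (cong f (⟦pointᵖ⟧ n))) (⟦constᵖ⟧ (C base) (n ∷ _ ∷ [])))
  ⟦probeᵖ⟧ : ∀ n → ⟦ probeᵖ ⟧ (n ∷ []) ≡ probe n
  ⟦probeᵖ⟧ n = trans (⟦∩ᵖ⟧ _) (cong₂ _∩_
    (trans (⟦fᵖ⟧ _) (cong f (⟦pointᵖ⟧ n))) (⟦constᵖ⟧ base (n ∷ [])))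

open Modality diagonal using (presentation; isModalAlgebra; isComputable)

no-punctual-copy : (Q : MAOps ℕ) → IsPunctual Q → ¬ (ℕPresentation.ops presentation ≅ Q)
no-punctual-copy Q punctual iso with probe-primRec punctual
... | probeᵖ , ⟦probeᵖ⟧ = Bool.not-¬ refl (trans (diagonal-compile p) differs-on-index)
  where
  p : PR 1
  -- `p` vanishes exactly off the diagonal set, whereas at its own index the diagonal set contains
  -- that index exactly when `p` vanishes there.
  p = compᵖ (differsᵖ (MAOps.𝟎 Q)) (probeᵖ ∷ [])
  differs-on-index : (⟦ p ⟧ (compile p ∷ []) ≡ᵇ 0) ≡ not (diagonal (compile p))
  differs-on-index = trans (differsᵖ-≡ᵇ (MAOps.𝟎 Q) _)
    (trans (cong (_≡ᵇ MAOps.𝟎 Q) (⟦probeᵖ⟧ (compile p ∷ []))) (copy-decides diagonal iso (compile p)))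

theorem10 : Σ ℕPresentation λ P → IsComputable P × InfiniteDom P × IsModalAlgebra (ℕPresentation.ops P) × ((Q : MAOps ℕ) → IsPunctual Q → IsModalAlgebra Q → ¬ (ℕPresentation.ops P ≅ Q))
theorem10 = presentation , isComputable diagonal-computable , (λ n → n , ≤-refl , refl) , isModalAlgebra
          , λ Q punctual _ → no-punctual-copy Q punctual
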